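{- Let $n$ and $k$ be integers with $3\leq k\leq n$. For every connected graph $G$ of order $n$, $$1\leq \kappa_k(G)\leq n-\lceil k/2\rceil.$$ Moreover, the upper and lower bounds are tight: there is a connected graph of order $n$ attaining the upper bound, and there is a connected graph of order $n$ attaining the lower bound.
   Context: All graphs are undirected, finite and simple. For a graph $G$ and a set $S\subseteq V(G)$ of at least two vertices, a tree connecting $S$ is a subgraph $T$ of $G$ that is a tree with $S\subseteq V(T)$. Two trees $T,T'$ connecting $S$ are internally disjoint if $E(T)\cap E(T')=\varnothing$ and $V(T)\cap V(T')=S$. Let $\kappa(S)$ be the maximum number of pairwise internally disjoint trees connecting $S$ in $G$. The generalized $k$-connectivity of $G$ is $\kappa_k(G)=\min\{\kappa(S) : S\subseteq V(G),\ |S|=k\}$. -}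

module Defs where

import Data.Bool.Properties as Bool
open import Data.Fin.Base using (Fin; zero; suc)
open import Data.Fin.Properties using (_≟_; any?; all?; injective⇒≤)
open import Data.Fin.Subset using (Subset; inside; outside; _∈_; _⊆_; _∩_; ∣_∣)
open import Data.Fin.Subset.Properties using (_∈?_; _⊆?_; anySubset?)
open import Data.List.Base as List using (List; []; _∷_; length; _∷ʳ_; allFin)
open import Data.List.Membership.Propositional using () renaming (_∈_ to _∈ˡ_)
open import Data.List.Membership.Propositional.Properties using (∈-allFin; ∈-lookup)
open import Data.List.Relation.Unary.All as All using ()
open import Data.List.Relation.Unary.AllPairs using (_∷_)
open import Data.List.Relation.Unary.Any using (here; there)
open import Data.List.Relation.Unary.Linked as Linked using (Linked; linked?)
open import Data.List.Relation.Unary.Unique.Propositional using (Unique)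
open import Data.List.Relation.Unary.Unique.DecPropositional using (unique?)
open import Data.Nat.Base using (ℕ; zero; suc; _≤_; _<_; z≤n; s≤s; s≤s⁻¹)
open import Data.Nat.Properties as ℕ using (≤-trans; m≤n⇒m<n∨m≡n; n≤1+n)
open import Data.Product.Base using (Σ; ∃; ∃₂; _×_; _,_; proj₁; proj₂)
open import Data.Sum.Base using (_⊎_; inj₁; inj₂)
open import Data.Vec.Base as Vec using (Vec; []; _∷_; lookup; tabulate)
open import Data.Vec.Properties using (lookup∘tabulate; []=⇒lookup; lookup⇒[]=; ≡-dec)
open import Function.Base using (_∘_)
open import Level using (0ℓ)
open import Relation.Binary.Construct.Closure.ReflexiveTransitive as Star using (Star; ε; _◅_; _◅◅_)
open import Relation.Binary.Core using (Rel)
import Relation.Binary.Definitions as B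
open import Relation.Binary.PropositionalEquality.Core using (_≡_; _≢_; refl; sym; trans; cong; subst)
open import Relation.Nullary using (Dec; yes; no; does; ¬_; contradiction)
open import Relation.Nullary.Decidable using (map′; _×-dec_; _⊎-dec_; _→-dec_; ¬?; dec-true)
open import Relation.Unary using (Pred; Decidable)

record Graph (n : ℕ) : Set₁ where
  infix 4 _~_ _~?_
  field
    _~_      : Rel (Fin n) 0ℓ
    _~?_     : B.Decidable _~_
    ~-sym    : B.Symmetric _~_
    ~-irrefl : ∀ {u} → ¬ u ~ u

Connected : ∀ {n} → Graph n → Set
Connected G = ∀ u v → Star (Graph._~_ G) u v

record Subgraph {n} (G : Graph n) : Set₁ where
  infix 4 _~_ _~?_
  field
    vertices   : Subset n
    _~_        : Rel (Fin n) 0ℓ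
    _~?_       : B.Decidable _~_
    ~-sym      : B.Symmetric _~_
    ~⇒adjacent : ∀ {u v} → u ~ v → Graph._~_ G u v
    ~⇒∈        : ∀ {u v} → u ~ v → u ∈ vertices

module _ {n} {G : Graph n} where

  -- u ∷ xs lists the distinct vertices of a cycle in cyclic order.
  IsCycle : Subgraph G → Fin n → List (Fin n) → Set
  IsCycle T u xs =
    2 ≤ length xs × Unique (u ∷ xs) × Linked (Subgraph._~_ T) ((u ∷ xs) ∷ʳ u)

  IsTree : Subgraph G → Set
  IsTree T =
    (∀ u v → u ∈ vertices → v ∈ vertices → Star _~_ u v) ×
    (∀ u xs → ¬ IsCycle T u xs)
    where open Subgraph T

  Connects : Subset n → Subgraph G → Set
  Connects S T = IsTree T × S ⊆ Subgraph.vertices T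

  InternallyDisjoint : Subset n → Subgraph G → Subgraph G → Set
  InternallyDisjoint S T T′ =
    (∀ u v → ¬ (Subgraph._~_ T u v × Subgraph._~_ T′ u v)) ×
    Subgraph.vertices T ∩ Subgraph.vertices T′ ≡ S

-- When S has at least two vertices every tree connecting S has an edge, so the
-- trees of such a family are automatically distinct.
IsPacking : ∀ {n m} (G : Graph n) → Subset n → (Fin m → Subgraph G) → Set
IsPacking G S T =
  (∀ i → Connects S (T i)) ×
  (∀ i j → i ≢ j → InternallyDisjoint S (T i) (T j))

HasPacking : ∀ {n} → Graph n → Subset n → ℕ → Set₁
HasPacking G S m = ∃ λ (T : Fin m → Subgraph G) → IsPacking G S T

IsMaximum : ∀ {ℓ} → Pred ℕ ℓ → ℕ → Set ℓ
IsMaximum P m = P m × (∀ {i} → P i → i ≤ m)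

IsMinimum : ∀ {ℓ} → Pred ℕ ℓ → ℕ → Set ℓ
IsMinimum P m = P m × (∀ {i} → P i → m ≤ i)

private

  maximum : ∀ {ℓ} {P : Pred ℕ ℓ} → Decidable P → P 0 →
            ∀ b → (∀ {i} → P i → i ≤ b) → ∃ (IsMaximum P)
  maximum P? p₀ zero    bnd = 0 , p₀ , bnd
  maximum {P = P} P? p₀ (suc b) bnd with P? (suc b)
  ... | yes p = suc b , p , bnd
  ... | no ¬p = maximum P? p₀ b λ {i} pᵢ → lower pᵢ (m≤n⇒m<n∨m≡n (bnd pᵢ))
    where
    lower : ∀ {i} → P i → (i < suc b) ⊎ (i ≡ suc b) → i ≤ b
    lower pᵢ (inj₁ i<1+b) = s≤s⁻¹ i<1+b
    lower pᵢ (inj₂ refl)  = contradiction pᵢ ¬p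

  minimum : ∀ {ℓ} {P : Pred ℕ ℓ} → Decidable P → ∀ {b} → P b → ∃ (IsMinimum P)
  minimum {P = P} P? {zero}  p = 0 , p , λ _ → z≤n
  minimum {P = P} P? {suc b} p with P? 0
  ... | yes p₀ = 0 , p₀ , λ _ → z≤n
  ... | no ¬p₀ with minimum {P = P ∘ suc} (P? ∘ suc) p
  ...   | m , pₘ , least = suc m , pₘ , λ {i} → least⁺ i
    where
    least⁺ : ∀ i → P i → suc m ≤ i
    least⁺ zero    p₀ = contradiction p₀ ¬p₀
    least⁺ (suc i) pᵢ = s≤s (least pᵢ)

private

  module Reachability {n} {_~_ : Rel (Fin n) 0ℓ} (_~?_ : B.Decidable _~_) where

    -- Reachability through intermediate vertices in a given list.
    Through : List (Fin n) → Rel (Fin n) 0ℓ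
    Through []       u v = u ≡ v ⊎ u ~ v
    Through (w ∷ ws) u v = Through ws u v ⊎ (Through ws u w × Through ws w v)

    through? : ∀ ws → B.Decidable (Through ws)
    through? []       u v = (u ≟ v) ⊎-dec (u ~? v)
    through? (w ∷ ws) u v = through? ws u v ⊎-dec (through? ws u w ×-dec through? ws w v)

    sound : ∀ ws {u v} → Through ws u v → Star _~_ u v
    sound []       (inj₁ refl)    = ε
    sound []       (inj₂ e)       = e ◅ ε
    sound (w ∷ ws) (inj₁ p)       = sound ws p
    sound (w ∷ ws) (inj₂ (p , q)) = sound ws p ◅◅ sound ws q

    step : ∀ ws {u v} → (u ≡ v) ⊎ (u ~ v) → Through ws u v
    step []       e = e
    step (w ∷ ws) e = inj₁ (step ws e)

    join : ∀ {ws u v w} → w ∈ˡ ws → Through ws u w → Through ws w v → Through ws u v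
    join (here refl) p q = inj₂ (to p , from q)
      where
      to : ∀ {w ws u} → Through (w ∷ ws) u w → Through ws u w
      to (inj₁ p)       = p
      to (inj₂ (p , _)) = p
      from : ∀ {w ws v} → Through (w ∷ ws) w v → Through ws w v
      from (inj₁ p)       = p
      from (inj₂ (_ , p)) = p
    join (there w∈) (inj₁ p)       (inj₁ q)       = inj₁ (join w∈ p q)
    join (there w∈) (inj₁ p)       (inj₂ (q , r)) = inj₂ (join w∈ p q , r)
    join (there w∈) (inj₂ (p , q)) (inj₁ r)       = inj₂ (p , join w∈ q r)
    join (there w∈) (inj₂ (p , _)) (inj₂ (_ , q)) = inj₂ (p , q)

    complete : ∀ {u v} → Star _~_ u v → Through (allFin n) u v
    complete ε        = step (allFin n) (inj₁ refl)
    complete (e ◅ es) = join (∈-allFin _) (step (allFin n) (inj₂ e)) (complete es)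

    star? : B.Decidable (Star _~_)
    star? u v = map′ (sound (allFin n)) complete (through? (allFin n) u v)

  anyList≤? : ∀ {n} {P : Pred (List (Fin n)) 0ℓ} → Decidable P →
              ∀ b → Dec (∃ λ xs → length xs ≤ b × P xs)
  anyList≤? P? zero = map′ (λ p → [] , z≤n , p) (λ { ([] , _ , p) → p }) (P? [])
  anyList≤? {P = P} P? (suc b) =
    map′ (λ { (inj₁ p) → [] , z≤n , p
            ; (inj₂ (x , xs , l , p)) → x ∷ xs , s≤s l , p })
         (λ { ([] , _ , p) → inj₁ p
            ; (x ∷ xs , s≤s l , p) → inj₂ (x , xs , l , p) })
         (P? [] ⊎-dec any? λ x → anyList≤? {P = P ∘ (x ∷_)} (P? ∘ (x ∷_)) b)

  lookup-injective : ∀ {A : Set} {xs : List A} → Unique xs →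
                     ∀ {i j} → List.lookup xs i ≡ List.lookup xs j → i ≡ j
  lookup-injective (_  ∷ _) {zero}  {zero}  _  = refl
  lookup-injective (x∉ ∷ _) {zero}  {suc j} eq = contradiction eq (All.lookup x∉ (∈-lookup j))
  lookup-injective (x∉ ∷ _) {suc i} {zero}  eq = contradiction (sym eq) (All.lookup x∉ (∈-lookup i))
  lookup-injective (_  ∷ u) {suc i} {suc j} eq = cong suc (lookup-injective u eq)

  module _ {n} {G : Graph n} (T : Subgraph G) where
    open Subgraph T

    isCycle? : ∀ u xs → Dec (IsCycle T u xs)
    isCycle? u xs =
      (2 ℕ.≤? length xs) ×-dec unique? _≟_ (u ∷ xs) ×-dec linked? _~?_ ((u ∷ xs) ∷ʳ u)

    anyCycle? : Dec (∃₂ (IsCycle T))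
    anyCycle? = any? λ u →
      map′ (λ { (xs , _ , c) → xs , c })
           (λ { (xs , c@(_ , uniq , _)) →
                xs , ≤-trans (n≤1+n _) (injective⇒≤ (lookup-injective uniq)) , c })
           (anyList≤? (isCycle? u) n)

    isTree? : Dec (IsTree T)
    isTree? =
      all? (λ u → all? λ v →
        (u ∈? vertices) →-dec ((v ∈? vertices) →-dec Reachability.star? _~?_ u v))
      ×-dec map′ (λ ¬c u xs c → ¬c (u , xs , c)) (λ ¬c (u , xs , c) → ¬c u xs c) (¬? anyCycle?)

private

  Searchable : Set → Set₁
  Searchable A = ∀ {P : Pred A 0ℓ} → Decidable P → Dec (∃ P)

  searchVec : ∀ {A} → Searchable A → ∀ m → Searchable (Vec A m)
  searchVec s zero    P? = map′ (λ p → [] , p) (λ { ([] , p) → p }) (P? [])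
  searchVec s (suc m) P? =
    map′ (λ (x , xs , p) → x ∷ xs , p) (λ { (x ∷ xs , p) → x , xs , p })
         (s λ x → searchVec s m (P? ∘ (x ∷_)))

  module Encoding {n} (G : Graph n) where

    -- A vertex set together with the neighbourhood of every vertex.
    Code : Set
    Code = Subset n × Vec (Subset n) n

    searchCode : Searchable Code
    searchCode P? =
      map′ (λ (V , E , p) → (V , E) , p) (λ ((V , E) , p) → V , E , p)
           (anySubset? λ V → searchVec anySubset? n λ E → P? (V , E))

    Adj : Code → Rel (Fin n) 0ℓ
    Adj (_ , E) u v = v ∈ lookup E u

    adj? : ∀ c → B.Decidable (Adj c)
    adj? (_ , E) u v = v ∈? lookup E u

    Valid : Code → Set
    Valid c = ∀ u v → Adj c u v → Adj c v u × Graph._~_ G u v × u ∈ proj₁ c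

    valid? : Decidable Valid
    valid? c = all? λ u → all? λ v →
      adj? c u v →-dec (adj? c v u ×-dec Graph._~?_ G u v ×-dec u ∈? proj₁ c)

    decode : ∀ c → Valid c → Subgraph G
    decode c valid = record
      { vertices   = proj₁ c
      ; _~_        = Adj c
      ; _~?_       = adj? c
      ; ~-sym      = λ e → proj₁ (valid _ _ e)
      ; ~⇒adjacent = λ e → proj₁ (proj₂ (valid _ _ e))
      ; ~⇒∈        = λ e → proj₂ (proj₂ (valid _ _ e))
      }

    module _ (T : Subgraph G) where
      open Subgraph T

      row : Fin n → Subset n
      row u = tabulate λ v → does (u ~? v)

      encode : Code
      encode = vertices , tabulate row

      encode⁺ : ∀ {u v} → u ~ v → Adj encode u v
      encode⁺ {u} {v} e = subst (v ∈_) (sym (lookup∘tabulate row u))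
        (lookup⇒[]= v (row u) (trans (lookup∘tabulate _ v) (dec-true (u ~? v) e)))

      encode⁻ : ∀ {u v} → Adj encode u v → u ~ v
      encode⁻ {u} {v} e with u ~? v
                           | trans (sym (lookup∘tabulate (λ w → does (u ~? w)) v))
                                   ([]=⇒lookup (subst (v ∈_) (lookup∘tabulate row u) e))
      ... | yes u~v | _ = u~v

      encode-valid : Valid encode
      encode-valid u v e =
        encode⁺ (~-sym (encode⁻ e)) , ~⇒adjacent (encode⁻ e) , ~⇒∈ (encode⁻ e)

      recode : Subgraph G
      recode = decode encode encode-valid

      recode-connects : ∀ {S} → Connects S T → Connects S recode
      recode-connects ((conn , acyc) , S⊆) =
        ( (λ u v u∈ v∈ → Star.map encode⁺ (conn u v u∈ v∈))
        , (λ u xs (l , uniq , lnk) → acyc u xs (l , uniq , Linked.map encode⁻ lnk))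
        ) , S⊆

    recode-disjoint : ∀ {S} T T′ → InternallyDisjoint S T T′ →
                      InternallyDisjoint S (recode T) (recode T′)
    recode-disjoint T T′ (disj , eq) =
      (λ u v (e , e′) → disj u v (encode⁻ T e , encode⁻ T′ e′)) , eq

  module _ {n} (G : Graph n) (S : Subset n) where
    open Encoding G

    isPacking? : ∀ {m} (T : Fin m → Subgraph G) → Dec (IsPacking G S T)
    isPacking? T =
      all? (λ i → isTree? (T i) ×-dec S ⊆? Subgraph.vertices (T i))
      ×-dec
      all? (λ i → all? λ j → ¬? (i ≟ j) →-dec
        (all? (λ u → all? λ v → ¬? (Subgraph._~?_ (T i) u v ×-dec Subgraph._~?_ (T j) u v))
         ×-dec ≡-dec Bool._≟_ _ _))

    hasPacking? : Decidable (HasPacking G S)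
    hasPacking? m =
      map′ (λ (cs , valid , p) → (λ i → decode (lookup cs i) (valid i)) , p)
           encodePacking
           (searchVec searchCode m good?)
      where
      Good : Pred (Vec Code m) 0ℓ
      Good cs = Σ (∀ i → Valid (lookup cs i)) λ valid →
        IsPacking G S λ i → decode (lookup cs i) (valid i)

      good? : Decidable Good
      good? cs with all? (λ i → valid? (lookup cs i))
      ... | no ¬valid = no λ (valid , _) → ¬valid valid
      ... | yes valid = map′ (valid ,_) proj₂ (isPacking? λ i → decode (lookup cs i) (valid i))

      module _ (T : Fin m → Subgraph G) (p : IsPacking G S T) where

        codes : Vec Code m
        codes = tabulate (encode ∘ T)

        at : ∀ i → encode (T i) ≡ lookup codes i
        at i = sym (lookup∘tabulate (encode ∘ T) i)

        Single : Code → Set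
        Single c = Σ (Valid c) λ v → Connects S (decode c v)

        Pair : Code → Code → Set
        Pair c c′ = ∀ v v′ → InternallyDisjoint S (decode c v) (decode c′ v′)

        single : ∀ i → Single (lookup codes i)
        single i = subst Single (at i) (encode-valid (T i) , recode-connects (T i) (proj₁ p i))

        pair : ∀ i j → i ≢ j → Pair (lookup codes i) (lookup codes j)
        pair i j i≢j =
          subst (λ c → Pair c (lookup codes j)) (at i) (subst (Pair (encode (T i))) (at j)
            λ _ _ → recode-disjoint (T i) (T j) (proj₂ p i j i≢j))

        good : ∃ Good
        good = codes , (λ i → proj₁ (single i)) , (λ i → proj₂ (single i))
             , λ i j i≢j → pair i j i≢j (proj₁ (single i)) (proj₁ (single j))

      encodePacking : HasPacking G S m → ∃ Good
      encodePacking (T , p) = good T p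

private

  member : ∀ {n} (S : Subset n) → 1 ≤ ∣ S ∣ → ∃ (_∈ S)
  member (inside  ∷ S) _   = zero , Vec.here
  member (outside ∷ S) 1≤S with member S 1≤S
  ... | x , x∈S = suc x , Vec.there x∈S

  twoMembers : ∀ {n} (S : Subset n) → 2 ≤ ∣ S ∣ → ∃₂ λ x y → x ∈ S × y ∈ S × x ≢ y
  twoMembers (inside ∷ S) (s≤s 1≤S) with member S 1≤S
  ... | y , y∈S = zero , suc y , Vec.here , Vec.there y∈S , λ ()
  twoMembers (outside ∷ S) 2≤S with twoMembers S 2≤S
  ... | x , y , x∈S , y∈S , x≢y =
    suc x , suc y , Vec.there x∈S , Vec.there y∈S , λ { refl → x≢y refl }

  packing≤n : ∀ {n} (G : Graph n) S → 2 ≤ ∣ S ∣ → ∀ {m} → HasPacking G S m → m ≤ n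
  packing≤n G S 2≤S (T , conn , disj) with twoMembers S 2≤S
  ... | x , y , x∈S , y∈S , x≢y = injective⇒≤ {f = λ i → proj₁ (neighbour i)} injective
    where
    first : ∀ i → Star (Subgraph._~_ (T i)) x y → ∃ (Subgraph._~_ (T i) x)
    first i ε       = contradiction refl x≢y
    first i (e ◅ _) = _ , e

    neighbour : ∀ i → ∃ (Subgraph._~_ (T i) x)
    neighbour i with conn i
    ... | (c , _) , S⊆ = first i (c x y (S⊆ x∈S) (S⊆ y∈S))

    injective : ∀ {i j} → proj₁ (neighbour i) ≡ proj₁ (neighbour j) → i ≡ j
    injective {i} {j} eq with i ≟ j
    ... | yes i≡j = i≡j
    ... | no  i≢j = contradiction
      (proj₂ (neighbour i) , subst (Subgraph._~_ (T j) x) (sym eq) (proj₂ (neighbour j)))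
      (proj₁ (disj i j i≢j) x _)

  subsetOfSize : ∀ {n} k → k ≤ n → ∃ λ (S : Subset n) → ∣ S ∣ ≡ k
  subsetOfSize {zero}  zero    _         = [] , refl
  subsetOfSize {suc n} zero    _ with subsetOfSize {n} zero z≤n
  ... | S , eq = outside ∷ S , eq
  subsetOfSize {suc n} (suc k) (s≤s k≤n) with subsetOfSize k k≤n
  ... | S , eq = inside ∷ S , cong suc eq

abstract

  maximumPacking : ∀ {n} (G : Graph n) (S : Subset n) → 2 ≤ ∣ S ∣ →
                   ∃ (IsMaximum (HasPacking G S))
  maximumPacking {n} G S 2≤S =
    maximum (hasPacking? G S) ((λ ()) , (λ ()) , (λ ())) n (packing≤n G S 2≤S)

κ : ∀ {n} (G : Graph n) (S : Subset n) → 2 ≤ ∣ S ∣ → ℕ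
κ G S 2≤S = proj₁ (maximumPacking G S 2≤S)

κ-isMaximum : ∀ {n} (G : Graph n) (S : Subset n) (2≤S : 2 ≤ ∣ S ∣) →
              IsMaximum (HasPacking G S) (κ G S 2≤S)
κ-isMaximum G S 2≤S = proj₂ (maximumPacking G S 2≤S)

IsκOfSize : ∀ {n} → Graph n → (k : ℕ) → 2 ≤ k → Pred ℕ 0ℓ
IsκOfSize {n} G k 2≤k c =
  ∃ λ (S : Subset n) → Σ (∣ S ∣ ≡ k) λ eq → c ≡ κ G S (subst (2 ≤_) (sym eq) 2≤k)

private

  isκOfSize? : ∀ {n} (G : Graph n) k (2≤k : 2 ≤ k) → Decidable (IsκOfSize G k 2≤k)
  isκOfSize? G k 2≤k c = anySubset? size?
    where
    size? : ∀ S → Dec (Σ (∣ S ∣ ≡ k) λ eq → c ≡ κ G S (subst (2 ≤_) (sym eq) 2≤k))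
    size? S with ∣ S ∣ ℕ.≟ k
    ... | no ≢k = no λ (eq , _) → ≢k eq
    ... | yes refl =
      map′ (refl ,_) (λ { (refl , p) → p }) (c ℕ.≟ κ G S 2≤k)

abstract

  minimumκ : ∀ {n} (G : Graph n) k (2≤k : 2 ≤ k) → k ≤ n → ∃ (IsMinimum (IsκOfSize G k 2≤k))
  minimumκ G k 2≤k k≤n with subsetOfSize k k≤n
  ... | S , eq = minimum (isκOfSize? G k 2≤k) (S , eq , refl)

generalizedConnectivity : ∀ {n} (k : ℕ) → 2 ≤ k → k ≤ n → Graph n → ℕ
generalizedConnectivity k 2≤k k≤n G = proj₁ (minimumκ G k 2≤k k≤n)

generalizedConnectivity-isMinimum :
  ∀ {n} k (2≤k : 2 ≤ k) (k≤n : k ≤ n) (G : Graph n) →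
  IsMinimum (IsκOfSize G k 2≤k) (generalizedConnectivity k 2≤k k≤n G)
generalizedConnectivity-isMinimum k 2≤k k≤n G = proj₂ (minimumκ G k 2≤k k≤n)

{-# OPTIONS --safe #-}

-- Upper bound: a tree that leaves S owns a vertex outside S, so there are at most n − k such trees;
-- the others are spanning trees of S and share its k(k − 1) ordered pairs, each taking 2(k − 1) of
-- them, so there are at most ⌊k/2⌋ of those. In the complete graph both counts are attained, by the
-- stars centred outside S together with ⌊k/2⌋ edge-disjoint double stars on S. A breadth-first
-- spanning tree gives κₖ ≥ 1, with equality for a star, where trees compete for the edge at a leaf.
--
-- Trees are built from parent pointers with strictly decreasing depth: a non-backtracking walk along
-- them that steps away from the root keeps doing so, so a cycle would leave its first vertex for the
-- parent and also return to it from the parent.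

module Submission where

open import Defs
open import Data.Bool.Base using (Bool; true; false; not)
open import Data.Bool.Properties using (not-¬)
open import Data.Empty using (⊥)
open import Data.Fin.Base using (Fin; zero; suc; toℕ; splitAt; punchOut; inject≤; _↑ˡ_; _↑ʳ_)
open import Data.Fin.Properties using
  ( _≟_; any?; suc-injective; injective⇒≤; punchOut-injective; splitAt-↑ˡ; splitAt-↑ʳ
  ; toℕ-injective; toℕ-inject≤; +↔⊎; *↔×; 2↔Bool; 0≢1+n )
open import Data.Fin.Subset using (Subset; inside; outside; _∈_; _∉_; _⊆_; _∩_; _∪_; ∁; ⁅_⁆; ⊤; ∣_∣)
open import Data.Fin.Subset.Properties using
  ( _∈?_; ∈⊤; ⊆-antisym; ⊆-refl; x∈p∩q⁺; x∈p∩q⁻; p⊆p∪q; x∈p∪q⁻; x∈p∪q⁺; x∈⁅x⁆; x∈⁅y⁆⇒x≡y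
  ; x∈∁p⇒x∉p; x∉p⇒x∈∁p; ∣∁p∣≡n∸∣p∣; ∩-comm )
open import Data.List.Base using (List; []; _∷_; _∷ʳ_)
import Data.List.Membership.Propositional as List
open import Data.List.Relation.Unary.All as All using (All; []; _∷_)
open import Data.List.Relation.Unary.AllPairs using ([]; _∷_)
open import Data.List.Relation.Unary.Any using (here; there)
open import Data.List.Relation.Unary.Linked using (Linked; [-]; _∷_)
open import Data.List.Relation.Unary.Unique.Propositional using (Unique)
open import Data.List.Relation.Unary.Unique.Propositional.Properties using (++⁺)
open import Data.Nat.Base using
  ( ℕ; zero; suc; _+_; _*_; _≤_; _<_; _∸_; ⌊_/2⌋; ⌈_/2⌉; z≤n; s≤s; NonZero )
open import Data.Nat.Properties as ℕ using (<⇒≤)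
open import Data.Product.Base using (∃; ∃-syntax; _×_; _,_; proj₁; proj₂)
open import Data.Product.Function.NonDependent.Propositional using (_×-↔_)
open import Data.Sum.Function.Propositional using (_⊎-↔_)
open import Data.Sum.Properties using (inj₁-injective; inj₂-injective)
open import Data.Sum.Base as Sum using (_⊎_; inj₁; inj₂)
open import Data.Vec.Base using ([]; _∷_; here; there)
open import Function.Base using (_∘_; _$_)
open import Function.Bundles using (_↔_; Inverse; Injection)
open import Function.Definitions using (Injective)
open import Function.Properties.Inverse using (↔⇒↣; ↔-refl; ↔-sym; ↔-trans)
open import Level using (0ℓ)
open import Relation.Binary.Construct.Closure.ReflexiveTransitive as Star using (Star; ε; _◅_; _◅◅_)
open import Relation.Binary.Core using (Rel)
import Relation.Binary.Definitions as B
open import Relation.Binary.PropositionalEquality using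
  ( _≡_; _≢_; refl; sym; trans; cong; subst; subst₂; module ≡-Reasoning )
open import Relation.Nullary using (Dec; yes; no; ¬_; contradiction)
open import Relation.Nullary.Decidable using (_×-dec_; _⊎-dec_; ¬?)
open import Relation.Unary using (Pred; Decidable)

-- Trees from parent pointers

data NonBacktracking {A : Set} : List A → Set where
  [-]   : ∀ {x} → NonBacktracking (x ∷ [])
  [-,-] : ∀ {x y} → NonBacktracking (x ∷ y ∷ [])
  _∷_   : ∀ {x y z zs} → x ≢ z → NonBacktracking (y ∷ z ∷ zs) →
          NonBacktracking (x ∷ y ∷ z ∷ zs)

unique⇒nonBacktracking : ∀ {A : Set} {x : A} {xs} → Unique (x ∷ xs) → NonBacktracking (x ∷ xs)
unique⇒nonBacktracking {xs = []}        _ = [-]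
unique⇒nonBacktracking {xs = _ ∷ []}    _ = [-,-]
unique⇒nonBacktracking {xs = _ ∷ _ ∷ _} ((_ ∷ x≢z ∷ _) ∷ uniq) =
  x≢z ∷ unique⇒nonBacktracking uniq

unique-∷ʳ : ∀ {A : Set} {x : A} {xs} → Unique (x ∷ xs) → Unique (xs ∷ʳ x)
unique-∷ʳ (x∉ ∷ uniq) = ++⁺ uniq ([] ∷ []) λ { (x∈ , here refl) → All.lookup x∉ x∈ refl }

tail : ∀ {A : Set} {x y : A} {zs} → NonBacktracking (x ∷ y ∷ zs) → NonBacktracking (y ∷ zs)
tail [-,-]    = [-]
tail (_ ∷ nb) = nb

-- `depth` need not be the distance to the root; a strict drop along every pointer is enough.
-- `parent` and `depth` are total functions with arbitrary values outside `vertices`, so a single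
-- formula can define a whole family of trees.
record RootedTree {n} (G : Graph n) : Set where
  field
    vertices : Subset n
    root     : Fin n
    parent   : Fin n → Fin n
    depth    : Fin n → ℕ
    root∈    : root ∈ vertices
    parent∈  : ∀ {v} → v ∈ vertices → v ≢ root → parent v ∈ vertices
    adjacent : ∀ {v} → v ∈ vertices → v ≢ root → Graph._~_ G v (parent v)
    descends : ∀ {v} → v ∈ vertices → v ≢ root → depth (parent v) < depth v

  Child : Rel (Fin n) 0ℓ
  Child u v = u ∈ vertices × u ≢ root × parent u ≡ v

  child? : B.Decidable Child
  child? u v = (u ∈? vertices) ×-dec ¬? (u ≟ root) ×-dec (parent u ≟ v)

  Edge : Rel (Fin n) 0ℓ
  Edge u v = Child u v ⊎ Child v u

  child⇒∈ : ∀ {u v} → Child u v → v ∈ vertices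
  child⇒∈ (u∈ , u≢r , refl) = parent∈ u∈ u≢r

  child⇒< : ∀ {u v} → Child u v → depth v < depth u
  child⇒< (u∈ , u≢r , refl) = descends u∈ u≢r

  child⇒adjacent : ∀ {u v} → Child u v → Graph._~_ G u v
  child⇒adjacent (u∈ , u≢r , refl) = adjacent u∈ u≢r

  child-functional : ∀ {u v w} → Child u v → Child u w → v ≡ w
  child-functional (_ , _ , refl) (_ , _ , refl) = refl

  subgraph : Subgraph G
  subgraph = record
    { vertices   = vertices
    ; _~_        = Edge
    ; _~?_       = λ u v → child? u v ⊎-dec child? v u
    ; ~-sym      = Sum.swap
    ; ~⇒adjacent = λ { (inj₁ c) → child⇒adjacent c ; (inj₂ c) → Graph.~-sym G (child⇒adjacent c) }
    ; ~⇒∈        = λ { (inj₁ c) → proj₁ c ; (inj₂ c) → child⇒∈ c }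
    }

  -- The recursion runs on a bound `d` for the depth, which drops at each parent.
  toRoot : ∀ d v → depth v ≤ d → v ∈ vertices → Star Edge v root
  toRoot d v v≤d v∈ with v ≟ root
  ... | yes refl = ε
  toRoot zero    v v≤0 v∈ | no v≢r = contradiction (ℕ.<-≤-trans (descends v∈ v≢r) v≤0) λ ()
  toRoot (suc d) v v≤d v∈ | no v≢r =
    inj₁ (v∈ , v≢r , refl) ◅
    toRoot d (parent v) (ℕ.≤-pred (ℕ.<-≤-trans (descends v∈ v≢r) v≤d)) (parent∈ v∈ v≢r)

  -- A walk that never backtracks cannot turn towards the root after a step away from it.
  climb : ∀ {a b} ys {z} → Child b a → Linked Edge (b ∷ ys ∷ʳ z) →
          NonBacktracking (a ∷ b ∷ ys ∷ʳ z) → depth b < depth z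
  climb []       b→a (inj₁ b→z ∷ _) (a≢z ∷ _) = contradiction (child-functional b→a b→z) a≢z
  climb []       b→a (inj₂ z→b ∷ _) _         = child⇒< z→b
  climb (_ ∷ _)  b→a (inj₁ b→c ∷ _) (a≢c ∷ _) = contradiction (child-functional b→a b→c) a≢c
  climb (_ ∷ ys) b→a (inj₂ c→b ∷ l) (_ ∷ nb)  = ℕ.<-trans (child⇒< c→b) (climb ys c→b l nb)

  -- By `climb`, after one step away from the root all later steps lead away from it. So either
  -- every step goes to a parent and the walk ends nearer the root than `b`, or its last step
  -- reaches `z` from the parent of `z`.
  arrive : ∀ b ys {z} → Linked Edge (b ∷ ys ∷ʳ z) → NonBacktracking (b ∷ ys ∷ʳ z) →
           depth z < depth b ⊎ ∃ λ w → w List.∈ b ∷ ys × Child z w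
  arrive b []       (inj₁ b→z ∷ _) _  = inj₁ (child⇒< b→z)
  arrive b []       (inj₂ z→b ∷ _) _  = inj₂ (b , here refl , z→b)
  arrive b (c ∷ ys) (e ∷ l) nb with arrive c ys l (tail nb)
  ... | inj₂ (w , w∈ , z→w) = inj₂ (w , there w∈ , z→w)
  arrive b (c ∷ ys) (inj₁ b→c ∷ l) nb | inj₁ z<c = inj₁ (ℕ.<-trans z<c (child⇒< b→c))
  arrive b (c ∷ ys) (inj₂ c→b ∷ l) nb | inj₁ z<c = contradiction (climb ys c→b l nb) (ℕ.<-asym z<c)

  acyclic : ∀ u xs → ¬ IsCycle subgraph u xs
  acyclic u (_ ∷ []) (s≤s () , _)
  acyclic u (x ∷ y ∷ ys) (_ , uniq@((_ ∷ u≢y ∷ _) ∷ (x∉ ∷ _)) , e ∷ e′ ∷ l) = absurd e e′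
    where
    nb : NonBacktracking (x ∷ y ∷ ys ∷ʳ u)
    nb = unique⇒nonBacktracking (unique-∷ʳ uniq)

    absurd : Edge u x → Edge x y → ⊥
    -- This walk starts and ends at `u`, so it is not `Unique`, but `u ≢ y` keeps it
    -- non-backtracking. It first steps away from the root and would have to end deeper than `x`, at
    -- the parent of `x`.
    absurd (inj₂ x→u) e′ = ℕ.<-asym (child⇒< x→u) (climb (y ∷ ys) x→u (e′ ∷ l) (u≢y ∷ nb))
    -- The walk is followed only from `y` on, so that `x` is not on it: a parent of `u` found there
    -- would repeat `x`.
    absurd (inj₁ u→x) e′ with arrive y ys l (tail nb)
    ... | inj₂ (w , w∈ , u→w) = All.lookup x∉ w∈ (child-functional u→x u→w)
    absurd (inj₁ u→x) (inj₁ x→y) | inj₁ u<y =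
      ℕ.<-asym u<y (ℕ.<-trans (child⇒< x→y) (child⇒< u→x))
    absurd (inj₁ u→x) (inj₂ y→x) | inj₁ u<y = ℕ.<-asym u<y (climb ys y→x l nb)

  isTree : IsTree subgraph
  isTree =
    (λ u v u∈ v∈ → toRoot _ u ℕ.≤-refl u∈ ◅◅ Star.reverse Sum.swap (toRoot _ v ℕ.≤-refl v∈))
    , acyclic

-- Breadth-first spanning trees

record ParentPointers {n} (_~_ : Rel (Fin n) 0ℓ) (root : Fin n) : Set where
  field
    parent   : Fin n → Fin n
    depth    : Fin n → ℕ
    adjacent : ∀ {v} → v ≢ root → v ~ parent v
    descends : ∀ {v} → v ≢ root → depth (parent v) < depth v

least : ∀ {P : Pred ℕ 0ℓ} → Decidable P → ∀ b → P b → ∃ (IsMinimum P)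
least P? zero p = zero , p , λ _ → z≤n
least {P} P? (suc b) p with P? 0
... | yes p₀ = 0 , p₀ , λ _ → z≤n
... | no ¬p₀ with least (P? ∘ suc) b p
...   | m , pₘ , minimal = suc m , pₘ , minimal⁺
  where
  minimal⁺ : ∀ {i} → P i → suc m ≤ i
  minimal⁺ {zero}  p₀ = contradiction p₀ ¬p₀
  minimal⁺ {suc i} pᵢ = s≤s (minimal pᵢ)

-- The relation is arbitrary because the search serves twice: on a connected graph, and on a packed
-- tree re-indexed by the members of `S`.
module _ {n} {_~_ : Rel (Fin n) 0ℓ} (_~?_ : B.Decidable _~_)
         (root : Fin n) (reach : ∀ v → Star _~_ v root) where

  Walk : ℕ → Pred (Fin n) 0ℓ
  Walk zero    v = v ≡ root
  Walk (suc d) v = ∃ λ w → v ~ w × Walk d w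

  walk? : ∀ v → Decidable (λ d → Walk d v)
  walk? v zero    = v ≟ root
  walk? v (suc d) = any? λ w → (v ~? w) ×-dec walk? w d

  fromStar : ∀ {v} → Star _~_ v root → ∃ λ d → Walk d v
  fromStar ε        = 0 , refl
  fromStar (e ◅ es) with fromStar es
  ... | d , p = suc d , _ , e , p

  shortest : ∀ v → ∃ (IsMinimum λ d → Walk d v)
  shortest v with fromStar (reach v)
  ... | d , p = least (walk? v) d p

  distance : Fin n → ℕ
  distance v = proj₁ (shortest v)

  closer : ∀ {v} d → Walk d v → ∃ λ w → v ≢ root → v ~ w × distance w < d
  -- At the root no vertex is closer; `root` is a filler, and the condition `v ≢ root` fails there.
  closer zero    v≡r           = root , λ v≢r → contradiction v≡r v≢r
  closer (suc d) (w , v~w , p) = w , λ _ → v~w , s≤s (proj₂ (proj₂ (shortest w)) p)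

  nextCloser : ∀ v → ∃ λ w → v ≢ root → v ~ w × distance w < distance v
  nextCloser v = closer (distance v) (proj₁ (proj₂ (shortest v)))

  parentPointers : ParentPointers _~_ root
  parentPointers = record
    { parent   = λ v → proj₁ (nextCloser v)
    ; depth    = distance
    ; adjacent = λ {v} v≢r → proj₁ (proj₂ (nextCloser v) v≢r)
    ; descends = λ {v} v≢r → proj₂ (proj₂ (nextCloser v) v≢r)
    }

spanningTree : ∀ {n} (G : Graph n) → Connected G → Fin n → RootedTree G
spanningTree G connected root = record
  { vertices = ⊤
  ; root     = root
  ; parent   = parent
  ; depth    = depth
  ; root∈    = ∈⊤
  ; parent∈  = λ _ _ → ∈⊤
  ; adjacent = λ _ → adjacent
  ; descends = λ _ → descends
  }
  where
  open ParentPointers (parentPointers (Graph._~?_ G) root λ v → connected v root)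

connected⇒packing : ∀ {n} (G : Graph n) → Connected G → Fin n → ∀ S → HasPacking G S 1
connected⇒packing G connected root S =
  (λ _ → subgraph) , (λ _ → isTree , λ _ → ∈⊤) , λ { zero zero 0≢0 → contradiction refl 0≢0 }
  where open RootedTree (spanningTree G connected root)

-- Counting the trees of a packing

record Enumeration {n} (S : Subset n) (k : ℕ) : Set where
  field
    enum           : Fin k → Fin n
    enum∈          : ∀ i → enum i ∈ S
    enum-injective : ∀ {i j} → enum i ≡ enum j → i ≡ j
    index          : ∀ {x} → x ∈ S → Fin k
    enum-index     : ∀ {x} (x∈ : x ∈ S) → enum (index x∈) ≡ x

  index-enum : ∀ i (p : enum i ∈ S) → index p ≡ i
  index-enum i p = enum-injective (enum-index p)

-- The size is a parameter of `Enumeration`, so `subst` can recast `∣ S ∣` in the shape that a later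
-- argument splits: `suc k`, `h + h′` or `2 + k`.
enumerate : ∀ {n} (S : Subset n) → Enumeration S ∣ S ∣
enumerate [] = record
  { enum = λ () ; enum∈ = λ () ; enum-injective = λ { {()} } ; index = λ () ; enum-index = λ () }
enumerate (inside ∷ S) = record
  { enum           = λ { zero → zero ; (suc i) → suc (enum i) }
  ; enum∈          = λ { zero → here ; (suc i) → there (enum∈ i) }
  ; enum-injective = λ { {zero}  {zero}  _  → refl
                       ; {suc i} {suc j} eq → cong suc (enum-injective (suc-injective eq)) }
  ; index          = λ { here → zero ; (there x∈) → suc (index x∈) }
  ; enum-index     = λ { here → refl ; (there x∈) → cong suc (enum-index x∈) }
  }
  where open Enumeration (enumerate S)
enumerate (outside ∷ S) = record
  { enum           = suc ∘ enum
  ; enum∈          = λ i → there (enum∈ i)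
  ; enum-injective = enum-injective ∘ suc-injective
  ; index          = λ { (there x∈) → index x∈ }
  ; enum-index     = λ { (there x∈) → cong suc (enum-index x∈) }
  }
  where open Enumeration (enumerate S)

finite-≤ : ∀ {a b} {A B : Set} → Fin a ↔ A → Fin b ↔ B →
           (f : A → B) → Injective _≡_ _≡_ f → a ≤ b
finite-≤ A↔ B↔ f f-injective =
  injective⇒≤ {f = Inverse.from B↔ ∘ f ∘ Inverse.to A↔}
    (Injection.injective (↔⇒↣ A↔) ∘ f-injective ∘ Injection.injective (↔⇒↣ (↔-sym B↔)))

-- Deleting `x` leaves `k` places for `y`, so the ordered pairs of distinct elements fit into
-- exactly `suc k * k` codes.
ordered : ∀ {k} (x y : Fin (suc k)) → x ≢ y → Fin (suc k) × Fin k
ordered x y x≢y = x , punchOut x≢y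

ordered-injective : ∀ {k} {x y x′ y′ : Fin (suc k)} (x≢y : x ≢ y) (x′≢y′ : x′ ≢ y′) →
                    ordered x y x≢y ≡ ordered x′ y′ x′≢y′ → x ≡ x′ × y ≡ y′
ordered-injective {x = x} x≢y x′≢y′ eq with refl ← cong proj₁ eq =
  refl , punchOut-injective x≢y x′≢y′ (cong proj₂ eq)

-- Each vertex other than the root contributes its edge to the parent in both directions, `false`
-- upwards and `true` downwards, `k * 2` arcs in all. Directed arcs avoid choosing an order for the
-- ends of an edge.
module Arcs {k} {_~_ : Rel (Fin (suc k)) 0ℓ} (~-sym : B.Symmetric _~_)
            (pointers : ParentPointers _~_ zero) where
  open ParentPointers pointers

  source target : Fin k × Bool → Fin (suc k)
  source (v , false) = suc v
  source (v , true)  = parent (suc v)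
  target (v , false) = parent (suc v)
  target (v , true)  = suc v

  arc-adjacent : ∀ a → source a ~ target a
  arc-adjacent (v , false) = adjacent λ ()
  arc-adjacent (v , true)  = ~-sym (adjacent λ ())

  closer-parent : ∀ v → depth (parent (suc v)) < depth (suc v)
  closer-parent v = descends λ ()

  source≢target : ∀ a → source a ≢ target a
  source≢target (v , false) eq = ℕ.<-irrefl (cong depth (sym eq)) (closer-parent v)
  source≢target (v , true)  eq = ℕ.<-irrefl (cong depth eq) (closer-parent v)

  -- This separates upward arcs from downward ones: if they coincided, two vertices would be parents
  -- of each other, each with smaller depth than the other.
  crossed : ∀ v w → suc v ≡ parent (suc w) → parent (suc v) ≡ suc w → ⊥
  crossed v w v≡pw pv≡w = ℕ.<-asym (closer-parent v)
    (subst₂ (λ x y → depth x < depth y) (sym v≡pw) (sym pv≡w) (closer-parent w))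

  arc-injective : ∀ a b → source a ≡ source b → target a ≡ target b → a ≡ b
  arc-injective (v , false) (w , false) s t = cong (_, false) (suc-injective s)
  arc-injective (v , true)  (w , true)  s t = cong (_, true) (suc-injective t)
  arc-injective (v , false) (w , true)  s t = contradiction t (crossed v w s)
  arc-injective (v , true)  (w , false) s t = contradiction s (crossed v w t)

module _ {n k c m} {G : Graph n} {S : Subset n}
         (S-enum : Enumeration S (suc k)) (∁S-enum : Enumeration (∁ S) c)
         (T : Fin m → Subgraph G) (packing : IsPacking G S T) where
  private
    connects = proj₁ packing
    disjoint = proj₂ packing
    module S = Enumeration S-enum
    module ∁S = Enumeration ∁S-enum
    module T i = Subgraph (T i)

  HasOuter : Fin m → Set
  HasOuter i = ∃ λ w → w ∈ T.vertices i × w ∈ ∁ S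

  hasOuter? : Decidable HasOuter
  hasOuter? i = any? λ w → (w ∈? T.vertices i) ×-dec (w ∈? ∁ S)

  Inner : Fin m → Rel (Fin (suc k)) 0ℓ
  Inner i x y = T._~_ i (S.enum x) (S.enum y)

  module _ i (¬outer : ¬ HasOuter i) where

    vertices⊆S : T.vertices i ⊆ S
    vertices⊆S {x} x∈ with x ∈? S
    ... | yes x∈S = x∈S
    ... | no  x∉S = contradiction (x , x∈ , x∉p⇒x∈∁p x∉S) ¬outer

    -- The tree stays inside `S`, so every vertex on the path has an index. Stating the ends by
    -- equations lets the path be taken apart step by step.
    inner-star : ∀ {x y u v} → u ≡ S.enum x → v ≡ S.enum y →
                 Star (T._~_ i) u v → Star (Inner i) x y
    inner-star u≡ v≡ ε with refl ← S.enum-injective (trans (sym u≡) v≡) = ε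
    inner-star refl v≡ (e ◅ es) =
      subst (T._~_ i _) w≡ e ◅ inner-star w≡ v≡ es
      where w≡ = sym (S.enum-index (vertices⊆S (T.~⇒∈ i (T.~-sym i e))))

    inner-connected : ∀ x y → Star (Inner i) x y
    inner-connected x y = inner-star refl refl $
      proj₁ (proj₁ (connects i)) _ _
        (proj₂ (connects i) (S.enum∈ x)) (proj₂ (connects i) (S.enum∈ y))

    open Arcs (T.~-sym i)
      (parentPointers (λ x y → T._~?_ i (S.enum x) (S.enum y)) zero λ x → inner-connected x zero)
      public

  -- Each vertex outside `S` offers as many slots as a spanning tree of `S` has arcs. Every tree
  -- then fills `k * 2` slots, and one injection counts both kinds of tree.
  Slot : Set
  Slot = Fin (suc k) × Fin k ⊎ Fin c × Fin k × Bool

  -- A tree inside S occupies ordered pairs of vertices of S; any other tree owns a vertex outside S.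
  slot : ∀ i → Dec (HasOuter i) → Fin k × Bool → Slot
  slot i (no ¬o)            a = inj₁ (ordered (source i ¬o a) (target i ¬o a) (source≢target i ¬o a))
  slot i (yes (w , _ , w∈)) a = inj₂ (∁S.index w∈ , a)

  -- Two different trees with a common slot would share an edge within `S` or a vertex outside it.
  slot-injectiveᵢ : ∀ i j p q a b → slot i p a ≡ slot j q b → i ≡ j
  slot-injectiveᵢ i j p q a b eq with i ≟ j
  ... | yes i≡j = i≡j
  slot-injectiveᵢ i j (no ¬o) (no ¬o′) a b eq | no i≢j
    with s , t ← ordered-injective (source≢target i ¬o a) (source≢target j ¬o′ b) (inj₁-injective eq) =
    contradiction
      (arc-adjacent i ¬o a , subst₂ (Inner j) (sym s) (sym t) (arc-adjacent j ¬o′ b))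
      (proj₁ (disjoint i j i≢j) _ _)
  slot-injectiveᵢ i j (yes (w , w∈ , w∉)) (yes (w′ , w′∈ , w′∉)) a b eq | no i≢j =
    contradiction
      (subst (w ∈_) (proj₂ (disjoint i j i≢j))
        (x∈p∩q⁺ (w∈ , subst (_∈ T.vertices j) (sym w≡w′) w′∈)))
      (x∈∁p⇒x∉p w∉)
    where
    w≡w′ : w ≡ w′
    w≡w′ = trans (sym (∁S.enum-index w∉))
             (trans (cong ∁S.enum (cong proj₁ (inj₂-injective eq))) (∁S.enum-index w′∉))

  slot-injectiveₐ : ∀ i p {a b} → slot i p a ≡ slot i p b → a ≡ b
  slot-injectiveₐ i (yes _)  eq = cong proj₂ (inj₂-injective eq)
  slot-injectiveₐ i (no ¬o) {a} {b} eq
    with s , t ← ordered-injective (source≢target i ¬o a) (source≢target i ¬o b) (inj₁-injective eq) =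
    arc-injective i ¬o a b s t

  slots : Fin m × Fin k × Bool → Slot
  slots (i , a) = slot i (hasOuter? i) a

  slots-injective : Injective _≡_ _≡_ slots
  slots-injective {i , a} {j , b} eq
    with refl ← slot-injectiveᵢ i j (hasOuter? i) (hasOuter? j) a b eq =
    cong (i ,_) (slot-injectiveₐ i (hasOuter? i) eq)

  packing-count : m * (k * 2) ≤ suc k * k + c * (k * 2)
  packing-count = finite-≤ (arcs m)
    (↔-trans +↔⊎ (*↔× ⊎-↔ arcs c)) slots slots-injective
    where
    arcs : ∀ l → Fin (l * (k * 2)) ↔ (Fin l × Fin k × Bool)
    arcs l = ↔-trans *↔× (↔-refl ×-↔ ↔-trans *↔× (↔-refl ×-↔ 2↔Bool))

⌊k/2⌋+[n∸k] : ∀ {k n} → k ≤ n → ⌊ k /2⌋ + (n ∸ k) ≡ n ∸ ⌈ k /2⌉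
⌊k/2⌋+[n∸k] {k} {n} k≤n = begin
  h + (n ∸ k)                 ≡⟨ ℕ.m+n∸n≡m _ h′ ⟨
  (h + (n ∸ k)) + h′ ∸ h′     ≡⟨ cong (_∸ h′) shuffle ⟩
  (h + h′) + (n ∸ k) ∸ h′     ≡⟨ cong (λ l → l + (n ∸ k) ∸ h′) (ℕ.⌊n/2⌋+⌈n/2⌉≡n k) ⟩
  k + (n ∸ k) ∸ h′            ≡⟨ cong (_∸ h′) (ℕ.m+[n∸m]≡n k≤n) ⟩
  n ∸ h′                      ∎
  where
  open ≡-Reasoning
  h h′ : ℕ
  h  = ⌊ k /2⌋
  h′ = ⌈ k /2⌉
  shuffle : (h + (n ∸ k)) + h′ ≡ (h + h′) + (n ∸ k)
  shuffle = trans (ℕ.+-assoc h _ h′)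
    (trans (cong (h +_) (ℕ.+-comm (n ∸ k) h′)) (sym (ℕ.+-assoc h h′ _)))

-- Each step takes 2 off both sides, from `c * 2` while it lasts and then from `k`.
m*2≤k+c*2⇒m≤⌊k/2⌋+c : ∀ m c k → m * 2 ≤ k + c * 2 → m ≤ ⌊ k /2⌋ + c
m*2≤k+c*2⇒m≤⌊k/2⌋+c zero    c       k le = z≤n
m*2≤k+c*2⇒m≤⌊k/2⌋+c (suc m) zero    (suc zero) (s≤s ())
m*2≤k+c*2⇒m≤⌊k/2⌋+c (suc m) zero    (suc (suc k)) (s≤s (s≤s le)) = s≤s (m*2≤k+c*2⇒m≤⌊k/2⌋+c m zero k le)
m*2≤k+c*2⇒m≤⌊k/2⌋+c (suc m) (suc c) k le =
  subst (suc m ≤_) (sym (ℕ.+-suc ⌊ k /2⌋ c))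
    (s≤s (m*2≤k+c*2⇒m≤⌊k/2⌋+c m c k (ℕ.≤-pred (ℕ.≤-pred (subst (suc m * 2 ≤_) shift le)))))
  where
  shift : k + suc c * 2 ≡ 2 + (k + c * 2)
  shift = trans (ℕ.+-suc k _) (cong suc (ℕ.+-suc k _))

*-cancel-arcs : ∀ k .{{_ : NonZero k}} m c → m * (k * 2) ≤ suc k * k + c * (k * 2) → m * 2 ≤ suc k + c * 2
*-cancel-arcs k m c le = ℕ.*-cancelʳ-≤ (m * 2) (suc k + c * 2) k (subst₂ _≤_ (swap m)
  (trans (cong (suc k * k +_) (swap c)) (sym (ℕ.*-distribʳ-+ k (suc k) (c * 2)))) le)
  where
  swap : ∀ l → l * (k * 2) ≡ l * 2 * k
  swap l = trans (cong (l *_) (ℕ.*-comm k 2)) (sym (ℕ.*-assoc l 2 k))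

packing≤ : ∀ {n k m} {G : Graph n} {S : Subset n} → 2 ≤ k → k ≤ n → ∣ S ∣ ≡ k →
           HasPacking G S m → m ≤ n ∸ ⌈ k /2⌉
-- From here `k` is one less than the size of `S`; the inner `suc _` makes it nonzero, so that it
-- can be cancelled.
packing≤ {n} {suc k@(suc _)} {m} {G} {S} 2≤k k≤n eq packing =
  subst (m ≤_) (⌊k/2⌋+[n∸k] k≤n) $ m*2≤k+c*2⇒m≤⌊k/2⌋+c m (n ∸ suc k) (suc k) $ *-cancel-arcs k m (n ∸ suc k) $
  packing-count (subst (Enumeration S) eq (enumerate S))
    (subst (Enumeration (∁ S)) (trans (∣∁p∣≡n∸∣p∣ S) (cong (n ∸_) eq)) (enumerate (∁ S)))
    (proj₁ packing) (proj₂ packing)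
packing≤ {k = suc zero} (s≤s ())

-- Packings in the complete graph

completeGraph : ∀ n → Graph n
completeGraph n = record
  { _~_      = _≢_
  ; _~?_     = λ u v → ¬? (u ≟ v)
  ; ~-sym    = λ u≢v → u≢v ∘ sym
  ; ~-irrefl = λ u≢u → u≢u refl
  }

completeGraph-connected : ∀ n → Connected (completeGraph n)
completeGraph-connected n u v with u ≟ v
... | yes refl = ε
... | no  u≢v  = u≢v ◅ ε

∩≡ : ∀ {n} {S V V′ : Subset n} → S ⊆ V → S ⊆ V′ →
     (∀ {x} → x ∈ V → x ∈ V′ → x ∈ S) → V ∩ V′ ≡ S
∩≡ {V = V} {V′} S⊆V S⊆V′ ∩⊆S = ⊆-antisym
  (λ x∈ → let x∈V , x∈V′ = x∈p∩q⁻ V V′ x∈ in ∩⊆S x∈V x∈V′)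
  (λ x∈ → x∈p∩q⁺ (S⊆V x∈ , S⊆V′ x∈))

disjoint-sym : ∀ {n} {G : Graph n} {S} {T T′ : Subgraph G} →
               InternallyDisjoint S T T′ → InternallyDisjoint S T′ T
disjoint-sym (edges , vertices) =
  (λ u v (e , e′) → edges u v (e′ , e)) , trans (∩-comm _ _) vertices

module _ {n} (S : Subset n) where

  module _ (w : Fin n) where

    starDepth : Fin n → ℕ
    starDepth v with v ≟ w
    ... | yes _ = 0
    ... | no  _ = 1

    starDepth-< : ∀ {v} → v ≢ w → starDepth w < starDepth v
    starDepth-< {v} v≢w with w ≟ w | v ≟ w
    ... | _      | yes v≡w = contradiction v≡w v≢w
    ... | no w≢w | no _    = contradiction refl w≢w
    ... | yes _  | no _    = s≤s z≤n

    w∈S∪⁅w⁆ : w ∈ S ∪ ⁅ w ⁆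
    w∈S∪⁅w⁆ = x∈p∪q⁺ (inj₂ (x∈⁅x⁆ w))

    star : RootedTree (completeGraph n)
    star = record
      { vertices = S ∪ ⁅ w ⁆
      ; root     = w
      ; parent   = λ _ → w
      ; depth    = starDepth
      ; root∈    = w∈S∪⁅w⁆
      ; parent∈  = λ _ _ → w∈S∪⁅w⁆
      ; adjacent = λ _ v≢w → v≢w
      ; descends = λ _ → starDepth-<
      }

    -- Every edge of the star has `w` as an end, and `w` is all that the star may add to `S`; a tree
    -- that avoids `w` can share neither.
    star-disjoint : (T : Subgraph (completeGraph n)) → S ⊆ Subgraph.vertices T →
                    w ∉ Subgraph.vertices T → InternallyDisjoint S (RootedTree.subgraph star) T
    star-disjoint T S⊆ w∉ = edges , ∩≡ (p⊆p∪q ⁅ w ⁆) S⊆ meet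
      where
      open Subgraph T
      edges : ∀ u v → ¬ (RootedTree.Edge star u v × u ~ v)
      edges u v (inj₁ (_ , _ , refl) , e) = w∉ (~⇒∈ (~-sym e))
      edges u v (inj₂ (_ , _ , refl) , e) = w∉ (~⇒∈ e)
      meet : ∀ {x} → x ∈ S ∪ ⁅ w ⁆ → x ∈ vertices → x ∈ S
      meet {x} x∈ x∈T with x∈p∪q⁻ S ⁅ w ⁆ x∈
      ... | inj₁ x∈S = x∈S
      ... | inj₂ x∈w = contradiction (subst (_∈ vertices) (x∈⁅y⁆⇒x≡y w x∈w) x∈T) w∉

  -- For each i < h there are two centres, labelled (i , false) and (i , true). Tree i joins them and
  -- attaches a vertex labelled (q , b) to the centre on its own side b if q < i, and to the opposite
  -- one if i < q; so of the four edges between the levels i < j, tree i takes the crossing two and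
  -- tree j the straight two.
  module DoubleStars {h h′} (h≤h′ : h ≤ h′) (S-enum : Enumeration S (h + h′)) where
    open Enumeration S-enum

    -- If `h < h′`, each level from `h` on holds a single vertex, which is the centre of no tree.
    position : Fin h ⊎ Fin h′ → ℕ × Bool
    position (inj₁ i) = toℕ i , false
    position (inj₂ i) = toℕ i , true

    label : Fin n → ℕ × Bool
    label v with v ∈? S
    ... | yes v∈ = position (splitAt h (index v∈))
    -- A default value: the double stars have vertex set `S`.
    ... | no  _  = 0 , false

    label-enum : ∀ t → label (enum t) ≡ position (splitAt h t)
    label-enum t with enum t ∈? S
    ... | yes p = cong (position ∘ splitAt h) (index-enum t p)
    ... | no ¬p = contradiction (enum∈ t) ¬p

    slotOf : Fin h → Bool → Fin (h + h′)
    slotOf i false = i ↑ˡ h′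
    slotOf i true  = h ↑ʳ inject≤ i h≤h′

    centre : Fin h → Bool → Fin n
    centre i b = enum (slotOf i b)

    label-centre : ∀ i b → label (centre i b) ≡ (toℕ i , b)
    label-centre i false = trans (label-enum (i ↑ˡ h′)) (cong position (splitAt-↑ˡ h i h′))
    label-centre i true  = trans (label-enum (h ↑ʳ inject≤ i h≤h′))
      (trans (cong position (splitAt-↑ʳ h h′ _)) (cong (_, true) (toℕ-inject≤ i h≤h′)))

    level : Fin n → ℕ
    level = proj₁ ∘ label

    level-centre : ∀ i b → level (centre i b) ≡ toℕ i
    level-centre i b = cong proj₁ (label-centre i b)

    side : ℕ → ℕ × Bool → Bool
    side i (q , b) with ℕ.<-cmp q i
    ... | B.tri< _ _ _ = b
    -- This hangs the centre labelled `true` from the root, the centre labelled `false`, which gives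
    -- the edge that joins the two.
    ... | B.tri≈ _ _ _ = false
    ... | B.tri> _ _ _ = not b

    side-level : ∀ i p → proj₁ p ≡ i → side i p ≡ false
    side-level i (q , b) refl with ℕ.<-cmp i i
    ... | B.tri< _ i≢i _ = contradiction refl i≢i
    ... | B.tri≈ _ _ _   = refl
    ... | B.tri> _ i≢i _ = contradiction refl i≢i

    -- The edge between labels `(i , b)` and `(j , c)` cannot lie in both trees: the equation of the
    -- tree with the larger index says that `b` and `c` agree, the other that they differ.
    side-clash : ∀ {i j b c} → i ≢ j → b ≡ side i (j , c) → c ≡ side j (i , b) → ⊥
    side-clash {i} {j} i≢j b≡ c≡ with ℕ.<-cmp j i | ℕ.<-cmp i j
    ... | B.tri≈ _ j≡i _   | _                = i≢j (sym j≡i)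
    ... | _                | B.tri≈ _ i≡j _   = i≢j i≡j
    ... | B.tri< j<i _ _   | B.tri< i<j _ _   = ℕ.<-asym j<i i<j
    ... | B.tri> _ _ i<j   | B.tri> _ _ j<i   = ℕ.<-asym j<i i<j
    ... | B.tri< _ _ _     | B.tri> _ _ _     = not-¬ (sym b≡) c≡
    ... | B.tri> _ _ _     | B.tri< _ _ _     = not-¬ (sym c≡) b≡

    module _ (i : Fin h) where

      root : Fin n
      root = centre i false

      parent : Fin n → Fin n
      parent v = centre i (side (toℕ i) (label v))

      -- Every vertex off level `i` gets 2, even when it hangs directly from the root, so the
      -- descent is checked without asking on which side it hangs.
      depth : Fin n → ℕ
      depth v with v ≟ root | level v ℕ.≟ toℕ i
      ... | yes _ | _     = 0
      ... | no _  | yes _ = 1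
      ... | no _  | no _  = 2

      depth-root : depth root ≡ 0
      depth-root with root ≟ root | level root ℕ.≟ toℕ i
      ... | yes _  | _ = refl
      ... | no r≢r | _ = contradiction refl r≢r

      depth-centre : ∀ b → depth (centre i b) ≤ 1
      depth-centre b with centre i b ≟ root | level (centre i b) ℕ.≟ toℕ i
      ... | yes _ | _     = z≤n
      ... | no _  | yes _ = s≤s z≤n
      ... | no _  | no ≢i = contradiction (level-centre i b) ≢i

      depth-nonroot : ∀ {v} → v ≢ root → 1 ≤ depth v
      depth-nonroot {v} v≢r with v ≟ root | level v ℕ.≟ toℕ i
      ... | yes v≡r | _     = contradiction v≡r v≢r
      ... | no _    | yes _ = s≤s z≤n
      ... | no _    | no _  = s≤s z≤n

      depth-otherLevel : ∀ {v} → v ≢ root → level v ≢ toℕ i → 2 ≤ depth v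
      depth-otherLevel {v} v≢r ≢i with v ≟ root | level v ℕ.≟ toℕ i
      ... | yes v≡r | _      = contradiction v≡r v≢r
      ... | no _    | yes ≡i = contradiction ≡i ≢i
      ... | no _    | no _   = s≤s (s≤s z≤n)

      depth-parent : ∀ {v} → v ≢ root → depth (parent v) < depth v
      depth-parent {v} v≢r = compare (level v ℕ.≟ toℕ i)
        where
        compare : Dec (level v ≡ toℕ i) → depth (parent v) < depth v
        compare (no ≢i)  =
          ℕ.≤-trans (s≤s (depth-centre (side (toℕ i) (label v)))) (depth-otherLevel v≢r ≢i)
        -- On level `i` the side is `false`, so the parent is the root itself.
        compare (yes ≡i) = subst (_< depth v)
          (sym (trans (cong (depth ∘ centre i) (side-level (toℕ i) (label v) ≡i)) depth-root))
          (depth-nonroot v≢r)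

      doubleStar : RootedTree (completeGraph n)
      doubleStar = record
        { vertices = S
        ; root     = root
        ; parent   = parent
        ; depth    = depth
        ; root∈    = enum∈ _
        ; parent∈  = λ _ _ → enum∈ _
        ; adjacent = λ _ v≢r v≡p → ℕ.<-irrefl (cong depth (sym v≡p)) (depth-parent v≢r)
        ; descends = λ _ → depth-parent
        }

      child-label : ∀ {u v} → RootedTree.Child doubleStar u v →
                    label v ≡ (toℕ i , side (toℕ i) (label u))
      child-label (_ , _ , refl) = label-centre i _

    -- A parent in tree `i` lies on level `i`. A common edge with the same parent in both trees
    -- therefore forces `i ≡ j`; with opposite parents it joins levels `i` and `j`, where
    -- `side-clash` applies.
    doubleStars-disjoint : ∀ i j → i ≢ j →
      InternallyDisjoint S (RootedTree.subgraph (doubleStar i)) (RootedTree.subgraph (doubleStar j))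
    doubleStars-disjoint i j i≢j = edges , ∩≡ ⊆-refl ⊆-refl λ x∈ _ → x∈
      where
      Childᵢ Childⱼ : Rel (Fin n) 0ℓ
      Childᵢ = RootedTree.Child (doubleStar i)
      Childⱼ = RootedTree.Child (doubleStar j)

      parallel : ∀ {u v} → Childᵢ u v → Childⱼ u v → ⊥
      parallel c d = i≢j (toℕ-injective (cong proj₁ (trans (sym (child-label i c)) (child-label j d))))

      opposite : ∀ {u v} → Childᵢ u v → Childⱼ v u → ⊥
      opposite {u} {v} c d = side-clash (i≢j ∘ toℕ-injective)
        (trans (cong proj₂ v≡) (cong (side (toℕ i)) (cong (_, _) (cong proj₁ u≡))))
        (trans (cong proj₂ u≡) (cong (side (toℕ j)) (cong (_, _) (cong proj₁ v≡))))
        where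
        v≡ = child-label i c
        u≡ = child-label j d

      edges : ∀ u v → ¬ (RootedTree.Edge (doubleStar i) u v × RootedTree.Edge (doubleStar j) u v)
      edges u v (inj₁ c , inj₁ d) = parallel c d
      edges u v (inj₁ c , inj₂ d) = opposite c d
      edges u v (inj₂ c , inj₁ d) = opposite c d
      edges u v (inj₂ c , inj₂ d) = parallel c d

  module _ {h h′ c} (h≤h′ : h ≤ h′) (S-enum : Enumeration S (h + h′))
           (∁S-enum : Enumeration (∁ S) c) where
    open DoubleStars h≤h′ S-enum
    open Enumeration ∁S-enum using (enum; enum∈; enum-injective)

    member : Fin h ⊎ Fin c → RootedTree (completeGraph n)
    member (inj₁ i) = doubleStar i
    member (inj₂ w) = star (enum w)

    S⊆member : ∀ x → S ⊆ RootedTree.vertices (member x)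
    S⊆member (inj₁ i) = ⊆-refl
    S⊆member (inj₂ w) = p⊆p∪q ⁅ enum w ⁆

    enum∉S : ∀ w → enum w ∉ S
    enum∉S w = x∈∁p⇒x∉p (enum∈ w)

    members-disjoint : ∀ x y → x ≢ y →
      InternallyDisjoint S (RootedTree.subgraph (member x)) (RootedTree.subgraph (member y))
    members-disjoint (inj₁ i) (inj₁ j) x≢y = doubleStars-disjoint i j (x≢y ∘ cong inj₁)
    members-disjoint (inj₂ w) (inj₁ i) _ =
      star-disjoint (enum w) (RootedTree.subgraph (doubleStar i)) (S⊆member (inj₁ i)) (enum∉S w)
    members-disjoint (inj₁ i) (inj₂ w) x≢y = disjoint-sym
      {T = RootedTree.subgraph (star (enum w))} {T′ = RootedTree.subgraph (doubleStar i)}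
      (members-disjoint (inj₂ w) (inj₁ i) (x≢y ∘ sym))
    members-disjoint (inj₂ w) (inj₂ w′) x≢y =
      star-disjoint (enum w) (RootedTree.subgraph (star (enum w′))) (S⊆member (inj₂ w′))
        λ w∈ → avoid (x∈p∪q⁻ S ⁅ enum w′ ⁆ w∈)
      where
      avoid : ¬ (enum w ∈ S ⊎ enum w ∈ ⁅ enum w′ ⁆)
      avoid (inj₁ w∈S) = enum∉S w w∈S
      avoid (inj₂ w∈)  = x≢y (cong inj₂ (enum-injective (x∈⁅y⁆⇒x≡y _ w∈)))

    members-packing : HasPacking (completeGraph n) S (h + c)
    members-packing =
      (λ x → RootedTree.subgraph (member (splitAt h x))) ,
      (λ x → RootedTree.isTree (member (splitAt h x)) , S⊆member (splitAt h x)) ,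
      (λ x y x≢y → members-disjoint (splitAt h x) (splitAt h y)
        (x≢y ∘ Injection.injective (↔⇒↣ (+↔⊎ {h}))))

completeGraph-packing : ∀ {n k} → k ≤ n → (S : Subset n) → ∣ S ∣ ≡ k →
                        HasPacking (completeGraph n) S (n ∸ ⌈ k /2⌉)
completeGraph-packing {n} {k} k≤n S eq =
  subst (HasPacking (completeGraph n) S) (⌊k/2⌋+[n∸k] k≤n) $
  members-packing S (ℕ.⌊n/2⌋≤⌈n/2⌉ k)
    (subst (Enumeration S) (trans eq (sym (ℕ.⌊n/2⌋+⌈n/2⌉≡n k))) (enumerate S))
    (subst (Enumeration (∁ S)) (trans (∣∁p∣≡n∸∣p∣ S) (cong (n ∸_) eq)) (enumerate (∁ S)))

-- The star graph attains the lower bound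

starGraph : ∀ n → Graph (suc n)
starGraph n = record
  { _~_      = λ u v → (u ≡ zero × v ≢ zero) ⊎ (v ≡ zero × u ≢ zero)
  ; _~?_     = λ u v → ((u ≟ zero) ×-dec ¬? (v ≟ zero)) ⊎-dec ((v ≟ zero) ×-dec ¬? (u ≟ zero))
  ; ~-sym    = Sum.swap
  ; ~-irrefl = λ { (inj₁ (≡0 , ≢0)) → ≢0 ≡0 ; (inj₂ (≡0 , ≢0)) → ≢0 ≡0 }
  }

starGraph-connected : ∀ n → Connected (starGraph n)
starGraph-connected n u v = toCentre u ◅◅ Star.reverse (Graph.~-sym (starGraph n)) (toCentre v)
  where
  toCentre : ∀ u → Star (Graph._~_ (starGraph n)) u zero
  toCentre zero    = ε
  toCentre (suc u) = inj₂ (refl , λ ()) ◅ ε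

-- Of two distinct members at most one is the centre `zero`. The second member `v` will force every
-- tree to have an edge at the leaf `suc u`.
twoWithLeaf : ∀ {n k} {S : Subset (suc n)} → Enumeration S (2 + k) →
              ∃ λ u → ∃ λ v → suc u ∈ S × v ∈ S × suc u ≢ v
twoWithLeaf S-enum = pick (enum zero) (enum (suc zero)) (enum∈ _) (enum∈ _)
  (λ eq → contradiction (enum-injective eq) 0≢1+n)
  where
  open Enumeration S-enum
  pick : ∀ x y → x ∈ _ → y ∈ _ → x ≢ y → ∃ λ u → ∃ λ v → suc u ∈ _ × v ∈ _ × suc u ≢ v
  pick (suc u) v       u∈ v∈ u≢v = u , v , u∈ , v∈ , u≢v
  pick zero    zero    _  _  0≢0 = contradiction refl 0≢0
  pick zero    (suc u) v∈ u∈ v≢u = u , zero , u∈ , v∈ , v≢u ∘ sym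

-- All trees must use the only edge at a leaf of the star lying in S.
starGraph-packing≤1 : ∀ {n m} {S : Subset (suc n)} → 2 ≤ ∣ S ∣ →
                      HasPacking (starGraph n) S m → m ≤ 1
starGraph-packing≤1 {n} {m} {S} 2≤S (T , connects , disjoint)
  with u , v , u∈ , v∈ , u≢v ← twoWithLeaf
         (subst (Enumeration S) (sym (ℕ.m+[n∸m]≡n 2≤S)) (enumerate S)) =
  -- The constant map into `Fin 1` is injective because any two indices coincide.
  injective⇒≤ {f = λ _ → zero} λ {i} {j} _ → same i j
  where
  leafEdge : ∀ i → Subgraph._~_ (T i) (suc u) zero
  leafEdge i = first (proj₁ (proj₁ (connects i)) _ _ (proj₂ (connects i) u∈) (proj₂ (connects i) v∈))
    where
    first : Star (Subgraph._~_ (T i)) (suc u) v → Subgraph._~_ (T i) (suc u) zero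
    first ε       = contradiction refl u≢v
    first (e ◅ _) with Subgraph.~⇒adjacent (T i) e
    ... | inj₂ (refl , _) = e

  same : ∀ i j → i ≡ j
  same i j with i ≟ j
  ... | yes i≡j = i≡j
  ... | no  i≢j = contradiction (leafEdge i , leafEdge j) (proj₁ (disjoint i j i≢j) _ _)

-- From packings to the generalized connectivity

module _ {n k} (2≤k : 2 ≤ k) (k≤n : k ≤ n) (G : Graph n) where

  -- Both bounds are read off at a set `S` attaining the minimum: this one from the maximality of
  -- `κ` at `S`, the next one from the packing that realises `κ` there.
  generalizedConnectivity-≥ : ∀ {c} → (∀ S → ∣ S ∣ ≡ k → HasPacking G S c) →
                              c ≤ generalizedConnectivity k 2≤k k≤n G
  generalizedConnectivity-≥ packing
    with (S , eq , κₖ≡) , _ ← generalizedConnectivity-isMinimum k 2≤k k≤n G =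
    subst (_ ≤_) (sym κₖ≡) (proj₂ (κ-isMaximum G S (subst (2 ≤_) (sym eq) 2≤k)) (packing S eq))

  generalizedConnectivity-≤ : ∀ {c} → (∀ S → ∣ S ∣ ≡ k → ∀ {m} → HasPacking G S m → m ≤ c) →
                              generalizedConnectivity k 2≤k k≤n G ≤ c
  generalizedConnectivity-≤ bound
    with (S , eq , κₖ≡) , _ ← generalizedConnectivity-isMinimum k 2≤k k≤n G =
    subst (_≤ _) (sym κₖ≡) (bound S eq (proj₁ (κ-isMaximum G S (subst (2 ≤_) (sym eq) 2≤k))))

proposition1 :
  ∀ (n k : ℕ) (3≤k : 3 ≤ k) (k≤n : k ≤ n) →
  let κₖ : Graph n → ℕ
      κₖ = generalizedConnectivity k (<⇒≤ 3≤k) k≤n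
  in (∀ (G : Graph n) → Connected G → 1 ≤ κₖ G × κₖ G ≤ n ∸ ⌈ k /2⌉)
   × (∃[ G ] (Connected G × κₖ G ≡ n ∸ ⌈ k /2⌉))
   × (∃[ G ] (Connected G × κₖ G ≡ 1))
proposition1 zero    k 3≤k k≤n = contradiction (ℕ.≤-trans 3≤k k≤n) λ ()
-- With at least one vertex, `zero` is available as the root of spanning trees and as the centre of
-- the star.
proposition1 (suc n) k 3≤k k≤n =
    (λ G connected → atLeast1 G connected , upper G)
  , ( completeGraph (suc n) , completeGraph-connected (suc n)
    , ℕ.≤-antisym (upper (completeGraph (suc n)))
        (generalizedConnectivity-≥ 2≤k k≤n _ (completeGraph-packing k≤n)) )
  , ( starGraph n , starGraph-connected n
    , ℕ.≤-antisym
        (generalizedConnectivity-≤ 2≤k k≤n (starGraph n) λ S eq →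
          starGraph-packing≤1 (subst (2 ≤_) (sym eq) 2≤k))
        (atLeast1 (starGraph n) (starGraph-connected n)) )
  where
  2≤k : 2 ≤ k
  2≤k = <⇒≤ 3≤k

  atLeast1 : ∀ G → Connected G → 1 ≤ generalizedConnectivity k 2≤k k≤n G
  atLeast1 G connected = generalizedConnectivity-≥ 2≤k k≤n G λ S _ →
    connected⇒packing G connected zero S

  upper : ∀ G → generalizedConnectivity k 2≤k k≤n G ≤ suc n ∸ ⌈ k /2⌉
  upper G = generalizedConnectivity-≤ 2≤k k≤n G λ S eq → packing≤ 2≤k k≤n eq
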